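{- If there exists an irreducible $(n,3)$-homogeneous subcube partition then $n=4$. Moreover, the irreducible $(4,3)$-homogeneous subcube partition is unique up to permutation of coordinates and flipping of coordinates (exchanging $0$ and $1$ in a coordinate).
   Context: Subcubes of $\{0,1\}^n$ are identified with words in $\{0,1,*\}^n$; the codimension is the number of non-$*$ positions. A subcube partition of length $n$ is a partition of $\{0,1\}^n$ into subcubes; it is irreducible if no subset $G$ with $1<|G|<|F|$ has a union that is a subcube, and tight if for every coordinate $i$ some subcube $s$ has $s_i\ne*$. An $(n,k)$-homogeneous subcube partition is a tight subcube partition of length $n$ all of whose subcubes have codimension $k$. -}

module Defs where

open import Data.Nat using (ℕ; zero; suc; _+_; _<_)
open import Data.Bool using (Bool; true; false; not)
open import Data.Fin using (Fin)
open import Data.Vec using (Vec; lookup; tabulate; []; _∷_)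
open import Data.List using (List; length)
import Data.List as List
open import Data.Fin.Subset using (Subset; ∣_∣) renaming (_∈_ to _∈ˢ_)
open import Data.Fin.Permutation using (Permutation′; _⟨$⟩ʳ_)
open import Data.Product using (Σ; ∃; _×_; _,_)
open import Data.Empty using (⊥)
open import Data.Unit using (⊤)
open import Relation.Nullary using (¬_)
open import Relation.Binary.PropositionalEquality using (_≡_)
open import Function.Bundles using (_⇔_)
open import Data.List.Membership.Propositional using (_∈_)

data Sym : Set where
  𝟘 𝟙 ⋆ : Sym

Cube : ℕ → Set
Cube n = Vec Sym n

Point : ℕ → Set
Point n = Vec Bool n

_≼_ : Bool → Sym → Set
false ≼ 𝟘 = ⊤
true  ≼ 𝟘 = ⊥
false ≼ 𝟙 = ⊥
true  ≼ 𝟙 = ⊤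
_     ≼ ⋆ = ⊤

_∈ᶜ_ : ∀ {n} → Point n → Cube n → Set
x ∈ᶜ s = ∀ i → lookup x i ≼ lookup s i

codim : ∀ {n} → Cube n → ℕ
codim [] = 0
codim (⋆ ∷ s) = codim s
codim (𝟘 ∷ s) = suc (codim s)
codim (𝟙 ∷ s) = suc (codim s)

Family : ℕ → Set
Family n = List (Cube n)

IsPartition : ∀ {n} → Family n → Set
IsPartition {n} F = ∀ (x : Point n) →
  Σ (Fin (length F)) λ i → (x ∈ᶜ List.lookup F i) ×
    (∀ j → x ∈ᶜ List.lookup F j → j ≡ i)

UnionIsSubcube : ∀ {n} (F : Family n) → Subset (length F) → Set
UnionIsSubcube {n} F G = Σ (Cube n) λ s → ∀ (x : Point n) →
  (x ∈ᶜ s) ⇔ (Σ (Fin (length F)) λ j → (j ∈ˢ G) × (x ∈ᶜ List.lookup F j))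

Irreducible : ∀ {n} → Family n → Set
Irreducible F = ∀ (G : Subset (length F)) → 1 < ∣ G ∣ → ∣ G ∣ < length F →
  ¬ UnionIsSubcube F G

Tight : ∀ {n} → Family n → Set
Tight {n} F = ∀ (i : Fin n) → Σ (Cube n) λ s → (s ∈ F) × ¬ (lookup s i ≡ ⋆)

Homogeneous : (n k : ℕ) → Family n → Set
Homogeneous n k F = IsPartition F × Tight F × (∀ s → s ∈ F → codim s ≡ k)

flipSym : Bool → Sym → Sym
flipSym false c = c
flipSym true 𝟘 = 𝟙
flipSym true 𝟙 = 𝟘
flipSym true ⋆ = ⋆

act : ∀ {n} → Permutation′ n → Vec Bool n → Cube n → Cube n
act σ f s = tabulate λ i → flipSym (lookup f i) (lookup s (σ ⟨$⟩ʳ i))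

-- F and G are equivalent up to permuting and flipping coordinates
-- (equality as sets of subcubes).
Equivalent : ∀ {n} → Family n → Family n → Set
Equivalent {n} F G = Σ (Permutation′ n) λ σ → Σ (Vec Bool n) λ f →
  ∀ (c : Cube n) → (c ∈ G) ⇔ (Σ (Cube n) λ s → (s ∈ F) × (c ≡ act σ f s))

{-# OPTIONS --safe #-}
{-
For a coordinate i let N₀, N₁, N⋆ count the subcubes with 0, 1, ⋆ in position i. Comparing volumes in
the two halves of the cube gives 2N₀ + N⋆ = 8 = 2N₁ + N⋆, so N₀ = N₁ ≤ 4. Projecting out i, the
subcubes with 0 and those with 1 cover the same set. Tightness excludes N₀ = 0; if N₀ = 4 the
subcubes with 0 fill a half-cube; if N₀ = 1 the two subcubes mentioning i merge. If N₀ = 2, the zeros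
p, p′ clash in a coordinate k: if some one q has q_k ≠ ⋆, its projection equals that of p or p′ and
they merge, and otherwise p and p′ merge along k. So N₀ = N₁ = 3 for every i, and counting the
non-⋆ positions in two ways gives 6n = 8 · 3.

For n = 4, a backtracking search that covers the points one after another and discards any family
containing two subcubes whose union is a subcube leaves only the images of F₄ under flips.
-}
module Submission where

open import Defs
open import Data.Bool as Bool using (Bool; true; false; not; _xor_)
open import Data.Bool.Properties using (not-¬)
open import Data.Empty using (⊥; ⊥-elim)
open import Data.Fin using (Fin; zero; suc)
open import Data.Fin.Permutation using () renaming (id to idₚ)
open import Data.Fin.Properties using (_≟_; any?; all?)
open import Data.Fin.Subset using (Subset; ∣_∣; ⁅_⁆) renaming (_∈_ to _∈ˢ_; ⊤ to ⊤ˢ)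
open import Data.Fin.Subset.Properties
  using (p⊂q⇒∣p∣<∣q∣; p⊆q⇒∣p∣≤∣q∣; ∣⊤∣≡n; ∣⁅x⁆∣≡1; ∈⊤; x∈⁅y⁆⇒x≡y; x∈⁅x⁆)
open import Data.List using (List; []; _∷_; _++_; length; filter; allFin; map)
import Data.List as List
open import Data.List.Membership.Propositional using (_∈_; find; lose)
open import Data.List.Membership.Propositional.Properties
  using (∈-filter⁺; ∈-allFin; ∈-lookup; ∈-map⁺; ∈-map⁻; ∈-++⁺ˡ; ∈-++⁺ʳ)
open import Data.List.Relation.Unary.All as All using (All; []; _∷_)
open import Data.List.Relation.Unary.All.Properties using (all-filter)
open import Data.List.Relation.Unary.AllPairs using ([]; _∷_)
open import Data.List.Relation.Unary.Any as Any using (Any; here; there)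
open import Data.List.Relation.Unary.Any.Properties using (lookup-index)
open import Data.List.Relation.Unary.Unique.Propositional using (Unique)
open import Data.List.Relation.Unary.Unique.Propositional.Properties using (allFin⁺; filter⁺)
open import Data.Nat using (ℕ; zero; suc; _+_; _*_; _^_; _≤_; _<_; z≤n; s≤s)
open import Data.Nat.Properties as ℕ using (+-*-semiring)
open import Data.Nat.Solver using (module +-*-Solver)
open import Data.Product using (Σ; ∃; _×_; _,_; proj₁; proj₂)
open import Data.Sum as Sum using (_⊎_; inj₁; inj₂; [_,_]′)
open import Data.Unit using (tt)
open import Data.Vec using (Vec; []; _∷_; lookup; _[_]≔_; replicate; tabulate; zipWith)
open import Data.Vec.Properties
  using (lookup∘update; lookup∘update′; []≔-idempotent; []≔-lookup; []≔-commutes;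
         lookup∘tabulate; tabulate-cong; tabulate∘lookup; ≡-dec; lookup⇒[]=; []=⇒lookup; lookup-zipWith)
open import Function using (_∘_)
open import Function.Bundles using (_⇔_; mk⇔; Equivalence)
open import Relation.Binary.PropositionalEquality
  using (_≡_; _≢_; refl; sym; trans; cong; cong₂; subst; module ≡-Reasoning)
open import Relation.Nullary using (¬_; Dec; yes; no; does; contradiction)
open import Relation.Nullary.Decidable using (dec-true; map′; toWitness; ¬?; _⊎-dec_; _×-dec_; _→-dec_)
open import Relation.Unary using (Decidable)
open import Algebra.Properties.CommutativeSemigroup ℕ.*-commutativeSemigroup using (x∙yz≈y∙xz)
open import Algebra.Properties.Semiring.Sum +-*-semiring
  using (sum; sum-cong-≗; ∑-distrib-+; ∑-comm; sum-replicate-zero; *-distribʳ-sum; *-distribˡ-sum)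

-- Subcubes and points

bit : Bool → Sym
bit false = 𝟘
bit true  = 𝟙

infix 4 _≟ˢ_ _≼?_ _∈?_

_≟ˢ_ : (c d : Sym) → Dec (c ≡ d)
𝟘 ≟ˢ 𝟘 = yes refl
𝟘 ≟ˢ 𝟙 = no λ ()
𝟘 ≟ˢ ⋆ = no λ ()
𝟙 ≟ˢ 𝟘 = no λ ()
𝟙 ≟ˢ 𝟙 = yes refl
𝟙 ≟ˢ ⋆ = no λ ()
⋆ ≟ˢ 𝟘 = no λ ()
⋆ ≟ˢ 𝟙 = no λ ()
⋆ ≟ˢ ⋆ = yes refl

_≼?_ : ∀ b c → Dec (b ≼ c)
false ≼? 𝟘 = yes tt
false ≼? 𝟙 = no λ ()
false ≼? ⋆ = yes tt
true  ≼? 𝟘 = no λ ()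
true  ≼? 𝟙 = yes tt
true  ≼? ⋆ = yes tt

∈-∷ : ∀ {n b c} (x : Point n) (s : Cube n) → b ≼ c → x ∈ᶜ s → (b ∷ x) ∈ᶜ (c ∷ s)
∈-∷ x s b≼c x∈s zero    = b≼c
∈-∷ x s b≼c x∈s (suc i) = x∈s i

_∈?_ : ∀ {n} (x : Point n) (s : Cube n) → Dec (x ∈ᶜ s)
[]      ∈? []      = yes λ ()
(b ∷ x) ∈? (c ∷ s) =
  map′ (λ (b≼c , x∈s) → ∈-∷ x s b≼c x∈s) (λ x∈ → x∈ zero , x∈ ∘ suc) (b ≼? c ×-dec x ∈? s)

≼-⋆ : ∀ b → b ≼ ⋆
≼-⋆ false = tt
≼-⋆ true  = tt

≼-bit : ∀ b → b ≼ bit b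
≼-bit false = tt
≼-bit true  = tt

≼-bit⁻ : ∀ b b′ → b ≼ bit b′ → b ≡ b′
≼-bit⁻ false false _ = refl
≼-bit⁻ true  true  _ = refl

bit-injective : ∀ b b′ → bit b ≡ bit b′ → b ≡ b′
bit-injective false false _ = refl
bit-injective true  true  _ = refl

bit≢⋆ : ∀ b → bit b ≢ ⋆
bit≢⋆ false ()
bit≢⋆ true  ()

⋆-or-bit : ∀ c → c ≡ ⋆ ⊎ ∃ λ b → c ≡ bit b
⋆-or-bit 𝟘 = inj₂ (false , refl)
⋆-or-bit 𝟙 = inj₂ (true , refl)
⋆-or-bit ⋆ = inj₁ refl

≢⇒≡not : ∀ b b′ → b ≢ b′ → b′ ≡ not b
≢⇒≡not false false b≢b = contradiction refl b≢b
≢⇒≡not false true  _   = refl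
≢⇒≡not true  false _   = refl
≢⇒≡not true  true  b≢b = contradiction refl b≢b

∃-≼ : ∀ c → ∃ λ b → b ≼ c
∃-≼ 𝟘 = false , tt
∃-≼ 𝟙 = true , tt
∃-≼ ⋆ = false , tt

∃-∈ : ∀ {n} (s : Cube n) → ∃ λ x → x ∈ᶜ s
∃-∈ []      = [] , λ ()
∃-∈ (c ∷ s) with b , b≼c ← ∃-≼ c | x , x∈s ← ∃-∈ s = b ∷ x , ∈-∷ x s b≼c x∈s

∈⇒lookup≡ : ∀ {n} x (s : Cube n) {i b} → x ∈ᶜ s → lookup s i ≡ bit b → lookup x i ≡ b
∈⇒lookup≡ x s {i} {b} x∈s eq = ≼-bit⁻ _ b (subst (lookup x i ≼_) eq (x∈s i))

∈-update₂ : ∀ {n} x (s : Cube n) {i b c} → x ∈ᶜ s → b ≼ c → (x [ i ]≔ b) ∈ᶜ (s [ i ]≔ c)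
∈-update₂ x s {i} {b} {c} x∈s b≼c j with j ≟ i
... | yes refl rewrite lookup∘update i x b | lookup∘update i s c = b≼c
... | no j≢i rewrite lookup∘update′ j≢i x b | lookup∘update′ j≢i s c = x∈s j

∈-update : ∀ {n} x (s : Cube n) {i b} → x ∈ᶜ s → b ≼ lookup s i → (x [ i ]≔ b) ∈ᶜ s
∈-update x s {i} {b} x∈s b≼ =
  subst ((x [ i ]≔ b) ∈ᶜ_) ([]≔-lookup s i) (∈-update₂ x s x∈s b≼)

∈-update-⋆ : ∀ {n} x (s : Cube n) {i} b → lookup s i ≡ ⋆ → x ∈ᶜ s → (x [ i ]≔ b) ∈ᶜ s
∈-update-⋆ x s {i} b eq x∈s = ∈-update x s x∈s (subst (b ≼_) (sym eq) (≼-⋆ b))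

update-id : ∀ {n} (x : Point n) {i b} → lookup x i ≡ b → x [ i ]≔ b ≡ x
update-id x {i} refl = []≔-lookup x i

∈-widen : ∀ {n} x (s : Cube n) i → x ∈ᶜ s → x ∈ᶜ (s [ i ]≔ ⋆)
∈-widen x s i x∈s =
  subst (_∈ᶜ (s [ i ]≔ ⋆)) ([]≔-lookup x i) (∈-update₂ x s x∈s (≼-⋆ _))

∈-widen-fix : ∀ {n} x (s : Cube n) {i b} →
              lookup s i ≡ bit b → x ∈ᶜ (s [ i ]≔ ⋆) → (x [ i ]≔ b) ∈ᶜ s
∈-widen-fix x s {i} {b} eq x∈ =
  subst ((x [ i ]≔ b) ∈ᶜ_)
    (trans ([]≔-idempotent s i) (trans (cong (s [ i ]≔_) (sym eq)) ([]≔-lookup s i)))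
    (∈-update₂ x (s [ i ]≔ ⋆) x∈ (≼-bit b))

∈-widen-unfix : ∀ {n} x (s : Cube n) {i b} → (x [ i ]≔ b) ∈ᶜ s → x ∈ᶜ (s [ i ]≔ ⋆)
∈-widen-unfix x s {i} {b} x∈ =
  subst (_∈ᶜ (s [ i ]≔ ⋆))
    (trans ([]≔-idempotent x i) ([]≔-lookup x i))
    (∈-update₂ (x [ i ]≔ b) s {c = ⋆} x∈ (≼-⋆ (lookup x i)))

-- Common points and clashing coordinates

meet-or-clash : ∀ c d → (∃ λ b → b ≼ c × b ≼ d) ⊎ (∃ λ b → c ≡ bit b × d ≡ bit (not b))
meet-or-clash 𝟘 𝟙 = inj₂ (false , refl , refl)
meet-or-clash 𝟙 𝟘 = inj₂ (true , refl , refl)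
meet-or-clash 𝟘 𝟘 = inj₁ (false , tt , tt)
meet-or-clash 𝟘 ⋆ = inj₁ (false , tt , tt)
meet-or-clash 𝟙 𝟙 = inj₁ (true , tt , tt)
meet-or-clash 𝟙 ⋆ = inj₁ (true , tt , tt)
meet-or-clash ⋆ d with b , b≼d ← ∃-≼ d = inj₁ (b , ≼-⋆ b , b≼d)

Meets : ∀ {n} → Cube n → Cube n → Set
Meets s t = ∃ λ x → x ∈ᶜ s × x ∈ᶜ t

-- As long as no coordinate carries opposite bits, a value allowed by both symbols can be picked
-- coordinate by coordinate, and these values form a common point. Meeting is thereby decided
-- without running through the points.
meet-or-clashᶜ : ∀ {n} (s t : Cube n) → Meets s t ⊎
                 (∃ λ k → ∃ λ b → lookup s k ≡ bit b × lookup t k ≡ bit (not b))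
meet-or-clashᶜ []      []      = inj₁ ([] , (λ ()) , (λ ()))
meet-or-clashᶜ (c ∷ s) (d ∷ t) with meet-or-clash c d
... | inj₂ (b , eqs)       = inj₂ (zero , b , eqs)
... | inj₁ (b , b≼c , b≼d) with meet-or-clashᶜ s t
...   | inj₁ (x , x∈s , x∈t)  = inj₁ (b ∷ x , ∈-∷ x s b≼c x∈s , ∈-∷ x t b≼d x∈t)
...   | inj₂ (k , b′ , eqs)   = inj₂ (suc k , b′ , eqs)

meets? : ∀ {n} (s t : Cube n) → Dec (Meets s t)
meets? s t with meet-or-clashᶜ s t
... | inj₁ meet = yes meet
... | inj₂ (k , b , s≡ , t≡) = no λ (x , x∈s , x∈t) →
  contradiction (trans (sym (∈⇒lookup≡ x s x∈s s≡)) (∈⇒lookup≡ x t x∈t t≡)) (not-¬ refl)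

disjoint⇒clash : ∀ {n} (s t : Cube n) → ¬ Meets s t →
                 ∃ λ k → ∃ λ b → lookup s k ≡ bit b × lookup t k ≡ bit (not b)
disjoint⇒clash s t disjoint with meet-or-clashᶜ s t
... | inj₁ meet  = contradiction meet disjoint
... | inj₂ clash = clash

-- Codimension and inclusion

fixes : Sym → ℕ
fixes ⋆ = 0
fixes 𝟘 = 1
fixes 𝟙 = 1

codim-∷ : ∀ {n} c (s : Cube n) → codim (c ∷ s) ≡ fixes c + codim s
codim-∷ 𝟘 s = refl
codim-∷ 𝟙 s = refl
codim-∷ ⋆ s = refl

codim≡sum : ∀ {n} (s : Cube n) → codim s ≡ sum (λ i → fixes (lookup s i))
codim≡sum []      = refl
codim≡sum (c ∷ s) = trans (codim-∷ c s) (cong (fixes c +_) (codim≡sum s))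

codim-update : ∀ {n} (s : Cube n) {i} b b′ → lookup s i ≡ bit b →
               codim (s [ i ]≔ bit b′) ≡ codim s
codim-update (_ ∷ s) {zero} false false refl = refl
codim-update (_ ∷ s) {zero} false true  refl = refl
codim-update (_ ∷ s) {zero} true  false refl = refl
codim-update (_ ∷ s) {zero} true  true  refl = refl
codim-update (c ∷ s) {suc i} b b′ eq =
  trans (codim-∷ c _) (trans (cong (fixes c +_) (codim-update s b b′ eq)) (sym (codim-∷ c s)))

≼-⊆⇒≡⊎⋆ : ∀ c d → (∀ b → b ≼ c → b ≼ d) → c ≡ d ⊎ (d ≡ ⋆ × fixes c ≡ 1)
≼-⊆⇒≡⊎⋆ 𝟘 𝟘 f = inj₁ refl
≼-⊆⇒≡⊎⋆ 𝟘 𝟙 f = ⊥-elim (f false tt)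
≼-⊆⇒≡⊎⋆ 𝟘 ⋆ f = inj₂ (refl , refl)
≼-⊆⇒≡⊎⋆ 𝟙 𝟘 f = ⊥-elim (f true tt)
≼-⊆⇒≡⊎⋆ 𝟙 𝟙 f = inj₁ refl
≼-⊆⇒≡⊎⋆ 𝟙 ⋆ f = inj₂ (refl , refl)
≼-⊆⇒≡⊎⋆ ⋆ 𝟘 f = ⊥-elim (f true tt)
≼-⊆⇒≡⊎⋆ ⋆ 𝟙 f = ⊥-elim (f false tt)
≼-⊆⇒≡⊎⋆ ⋆ ⋆ f = inj₁ refl

⊆-tail : ∀ {n c d} (s t : Cube n) →
         (∀ x → x ∈ᶜ (c ∷ s) → x ∈ᶜ (d ∷ t)) → ∀ x → x ∈ᶜ s → x ∈ᶜ t
⊆-tail {c = c} s t s⊆t x x∈s i with b , b≼c ← ∃-≼ c =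
  s⊆t (b ∷ x) (∈-∷ x s b≼c x∈s) (suc i)

⊆-head : ∀ {n c d} (s t : Cube n) →
         (∀ x → x ∈ᶜ (c ∷ s) → x ∈ᶜ (d ∷ t)) → ∀ b → b ≼ c → b ≼ d
⊆-head s t s⊆t b b≼c with x , x∈s ← ∃-∈ s = s⊆t (b ∷ x) (∈-∷ x s b≼c x∈s) zero

⊆⇒codim≥ : ∀ {n} (s t : Cube n) → (∀ x → x ∈ᶜ s → x ∈ᶜ t) → codim t ≤ codim s
⊆⇒codim≥ []      []      _   = z≤n
⊆⇒codim≥ (c ∷ s) (d ∷ t) s⊆t
  rewrite codim-∷ c s | codim-∷ d t
  with ≼-⊆⇒≡⊎⋆ c d (⊆-head s t s⊆t) | ⊆⇒codim≥ s t (⊆-tail s t s⊆t)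
... | inj₁ refl       | le = ℕ.+-monoʳ-≤ (fixes c) le
... | inj₂ (refl , _) | le = ℕ.≤-trans le (ℕ.m≤n+m _ (fixes c))

-- In each coordinate an inclusion either keeps the symbol or replaces a bit by `⋆`. The second
-- lowers the codimension, and no other coordinate can make up for it.
⊆∧codim≡⇒≡ : ∀ {n} (s t : Cube n) → (∀ x → x ∈ᶜ s → x ∈ᶜ t) → codim s ≡ codim t → s ≡ t
⊆∧codim≡⇒≡ []      []      _   _  = refl
⊆∧codim≡⇒≡ (c ∷ s) (d ∷ t) s⊆t eq
  rewrite codim-∷ c s | codim-∷ d t
  with ≼-⊆⇒≡⊎⋆ c d (⊆-head s t s⊆t)
... | inj₁ refl = cong (c ∷_) (⊆∧codim≡⇒≡ s t (⊆-tail s t s⊆t) (ℕ.+-cancelˡ-≡ (fixes c) _ _ eq))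
-- The head is fixed on the left and free on the right, so equal codimensions would make the tail
-- `t` of larger codimension than `s`, against the inclusion of the tails.
... | inj₂ (refl , c-fixed) rewrite c-fixed =
  contradiction (⊆⇒codim≥ s t (⊆-tail s t s⊆t)) (ℕ.<⇒≱ (ℕ.≤-reflexive eq))

-- Volumes

sumPoints : ∀ n → (Point n → ℕ) → ℕ
sumPoints zero    f = f []
sumPoints (suc n) f = sumPoints n (f ∘ (false ∷_)) + sumPoints n (f ∘ (true ∷_))

sumPoints-cong : ∀ n {f g : Point n → ℕ} → (∀ x → f x ≡ g x) → sumPoints n f ≡ sumPoints n g
sumPoints-cong zero    f≗g = f≗g []
sumPoints-cong (suc n) f≗g = cong₂ _+_ (sumPoints-cong n (f≗g ∘ _)) (sumPoints-cong n (f≗g ∘ _))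

sumPoints-* : ∀ n k (f : Point n → ℕ) → sumPoints n (λ x → k * f x) ≡ k * sumPoints n f
sumPoints-* zero    k f = refl
sumPoints-* (suc n) k f =
  trans (cong₂ _+_ (sumPoints-* n k _) (sumPoints-* n k _)) (sym (ℕ.*-distribˡ-+ k _ _))

sumPoints-sum : ∀ n {m} (f : Fin m → Point n → ℕ) →
                sumPoints n (λ x → sum (λ j → f j x)) ≡ sum (λ j → sumPoints n (f j))
sumPoints-sum zero    f = refl
sumPoints-sum (suc n) f =
  trans (cong₂ _+_ (sumPoints-sum n (λ j → f j ∘ _)) (sumPoints-sum n (λ j → f j ∘ _)))
        (sym (∑-distrib-+ (λ j → sumPoints n (f j ∘ _)) _))

ind : Bool → Sym → ℕ
ind false 𝟙 = 0
ind true  𝟘 = 0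
ind _     _ = 1

indᶜ : ∀ {n} → Point n → Cube n → ℕ
indᶜ []      []      = 1
indᶜ (b ∷ x) (c ∷ s) = ind b c * indᶜ x s

ind-≼ : ∀ b c → b ≼ c → ind b c ≡ 1
ind-≼ false 𝟘 _ = refl
ind-≼ false ⋆ _ = refl
ind-≼ true  𝟙 _ = refl
ind-≼ true  ⋆ _ = refl

ind-⋠ : ∀ b c → ¬ b ≼ c → ind b c ≡ 0
ind-⋠ false 𝟘 ⋠ = contradiction tt ⋠
ind-⋠ false 𝟙 _ = refl
ind-⋠ false ⋆ ⋠ = contradiction tt ⋠
ind-⋠ true  𝟘 _ = refl
ind-⋠ true  𝟙 ⋠ = contradiction tt ⋠
ind-⋠ true  ⋆ ⋠ = contradiction tt ⋠

indᶜ-∈ : ∀ {n} (x : Point n) s → x ∈ᶜ s → indᶜ x s ≡ 1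
indᶜ-∈ []      []      _  = refl
indᶜ-∈ (b ∷ x) (c ∷ s) x∈ rewrite ind-≼ b c (x∈ zero) | indᶜ-∈ x s (x∈ ∘ suc) = refl

indᶜ-∉ : ∀ {n} (x : Point n) s → ¬ x ∈ᶜ s → indᶜ x s ≡ 0
indᶜ-∉ []      []      x∉ = contradiction (λ ()) x∉
indᶜ-∉ (b ∷ x) (c ∷ s) x∉ with b ≼? c
... | no b⋠c rewrite ind-⋠ b c b⋠c = refl
... | yes b≼c rewrite indᶜ-∉ x s (λ x∈s → x∉ (∈-∷ x s b≼c x∈s)) = ℕ.*-zeroʳ (ind b c)

scale : Sym → ℕ
scale ⋆ = 1
scale _ = 2

2^codim-∷ : ∀ {n} c (s : Cube n) → 2 ^ codim (c ∷ s) ≡ scale c * 2 ^ codim s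
2^codim-∷ 𝟘 s = refl
2^codim-∷ 𝟙 s = refl
2^codim-∷ ⋆ s = sym (ℕ.+-identityʳ _)

-- Twice the fraction of the points of c lying on side b.
weight : Bool → Sym → ℕ
weight false 𝟘 = 2
weight true  𝟙 = 2
weight _     ⋆ = 1
weight _     _ = 0

volume-head : ∀ c → (ind false c + ind true c) * scale c ≡ 2
volume-head 𝟘 = refl
volume-head 𝟙 = refl
volume-head ⋆ = refl

half-head : ∀ b c →
  (ind false (bit b) * ind false c + ind true (bit b) * ind true c) * scale c ≡ weight b c
half-head false 𝟘 = refl
half-head false 𝟙 = refl
half-head false ⋆ = refl
half-head true  𝟘 = refl
half-head true  𝟙 = refl
half-head true  ⋆ = refl

-- The count factors over the coordinates: a `⋆` doubles the number of points, a fixed symbol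
-- doubles `2 ^ codim s`. Keeping the power of two as a factor avoids division.
volume : ∀ {n} (s : Cube n) → sumPoints n (λ x → indᶜ x s) * 2 ^ codim s ≡ 2 ^ n
volume []      = refl
volume {suc n} (c ∷ s)
  rewrite sumPoints-* n (ind false c) (λ x → indᶜ x s)
        | sumPoints-* n (ind true c) (λ x → indᶜ x s)
        | 2^codim-∷ c s = begin
  (p * S + q * S) * (r * K)  ≡⟨ solve 5 (λ p q r S K → (p :* S :+ q :* S) :* (r :* K) := ((p :+ q) :* r) :* (S :* K)) refl p q r S K ⟩
  ((p + q) * r) * (S * K)    ≡⟨ cong₂ _*_ (volume-head c) (volume s) ⟩
  2 * 2 ^ n                  ∎
  where
  open ≡-Reasoning
  open +-*-Solver
  p = ind false c
  q = ind true c
  r = scale c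
  S = sumPoints n (λ x → indᶜ x s)
  K = 2 ^ codim s

-- The factor `ind (lookup x i) (bit b)` keeps only the points with value `b` at `i`. Coordinate `i`
-- then contributes `weight b (lookup s i)` and every other one contributes 2; the extra 2 on the
-- left is there because `weight` is a doubled fraction.
half-volume : ∀ {n} b (s : Cube n) i →
  sumPoints n (λ x → ind (lookup x i) (bit b) * indᶜ x s) * 2 ^ codim s * 2
    ≡ weight b (lookup s i) * 2 ^ n
half-volume {suc n} b (c ∷ s) zero
  rewrite sumPoints-cong n (λ x → sym (ℕ.*-assoc (ind false (bit b)) (ind false c) (indᶜ x s)))
        | sumPoints-cong n (λ x → sym (ℕ.*-assoc (ind true (bit b)) (ind true c) (indᶜ x s)))
        | sumPoints-* n (ind false (bit b) * ind false c) (λ x → indᶜ x s)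
        | sumPoints-* n (ind true (bit b) * ind true c) (λ x → indᶜ x s)
        | 2^codim-∷ c s = begin
  (p * S + q * S) * (r * K) * 2  ≡⟨ solve 5 (λ p q r S K → (p :* S :+ q :* S) :* (r :* K) :* con 2 := ((p :+ q) :* r) :* (con 2 :* (S :* K))) refl p q r S K ⟩
  ((p + q) * r) * (2 * (S * K))  ≡⟨ cong₂ (λ u v → u * (2 * v)) (half-head b c) (volume s) ⟩
  weight b c * 2 ^ suc n         ∎
  where
  open ≡-Reasoning
  open +-*-Solver
  p = ind false (bit b) * ind false c
  q = ind true (bit b) * ind true c
  r = scale c
  S = sumPoints n (λ x → indᶜ x s)
  K = 2 ^ codim s
half-volume {suc n} b (c ∷ s) (suc i)
  rewrite sumPoints-cong n (λ x → x∙yz≈y∙xz (ind (lookup x i) (bit b)) (ind false c) (indᶜ x s))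
        | sumPoints-cong n (λ x → x∙yz≈y∙xz (ind (lookup x i) (bit b)) (ind true c) (indᶜ x s))
        | sumPoints-* n (ind false c) (λ x → ind (lookup x i) (bit b) * indᶜ x s)
        | sumPoints-* n (ind true c) (λ x → ind (lookup x i) (bit b) * indᶜ x s)
        | 2^codim-∷ c s = begin
  (p * S + q * S) * (r * K) * 2    ≡⟨ solve 5 (λ p q r S K → (p :* S :+ q :* S) :* (r :* K) :* con 2 := ((p :+ q) :* r) :* (S :* K :* con 2)) refl p q r S K ⟩
  ((p + q) * r) * (S * K * 2)      ≡⟨ cong₂ _*_ (volume-head c) (half-volume b s i) ⟩
  2 * (w * 2 ^ n)                  ≡⟨ solve 2 (λ w N → con 2 :* (w :* N) := w :* (con 2 :* N)) refl w (2 ^ n) ⟩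
  w * 2 ^ suc n                    ∎
  where
  open ≡-Reasoning
  open +-*-Solver
  p = ind false c
  q = ind true c
  r = scale c
  w = weight b (lookup s i)
  S = sumPoints n (λ x → ind (lookup x i) (bit b) * indᶜ x s)
  K = 2 ^ codim s

∈-replicate-⋆ : ∀ {n} (x : Point n) → x ∈ᶜ replicate n ⋆
∈-replicate-⋆ (b ∷ x) = ∈-∷ x _ (≼-⋆ b) (∈-replicate-⋆ x)
∈-replicate-⋆ []      ()

codim-replicate-⋆ : ∀ n → codim (replicate n ⋆) ≡ 0
codim-replicate-⋆ zero    = refl
codim-replicate-⋆ (suc n) = codim-replicate-⋆ n

weight-replicate-⋆ : ∀ {n} b (i : Fin n) → weight b (lookup (replicate n ⋆) i) ≡ 1
weight-replicate-⋆ false zero    = refl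
weight-replicate-⋆ true  zero    = refl
weight-replicate-⋆ b     (suc i) = weight-replicate-⋆ b i

-- This is `half-volume` for the whole cube, seen as the subcube `replicate n ⋆` of codimension 0
-- and weight 1.
half-volume-⋆ : ∀ {n} b (i : Fin n) →
                sumPoints n (λ x → ind (lookup x i) (bit b)) * 2 ≡ 2 ^ n
half-volume-⋆ {n} b i = begin
  sumPoints n (λ x → ind (lookup x i) (bit b)) * 2
    ≡⟨ cong (_* 2) (sym (ℕ.*-identityʳ (sumPoints n _))) ⟩
  sumPoints n (λ x → ind (lookup x i) (bit b)) * 1 * 2
    ≡⟨ cong₂ (λ u k → u * 2 ^ k * 2)
         (sumPoints-cong n λ x → trans (sym (ℕ.*-identityʳ _))
           (cong (ind (lookup x i) (bit b) *_) (sym (indᶜ-∈ x (replicate n ⋆) (∈-replicate-⋆ x)))))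
         (sym (codim-replicate-⋆ n)) ⟩
  sumPoints n (λ x → ind (lookup x i) (bit b) * indᶜ x (replicate n ⋆)) * 2 ^ codim (replicate n ⋆) * 2
    ≡⟨ half-volume b (replicate n ⋆) i ⟩
  weight b (lookup (replicate n ⋆) i) * 2 ^ n
    ≡⟨ cong (_* 2 ^ n) (weight-replicate-⋆ b i) ⟩
  1 * 2 ^ n
    ≡⟨ ℕ.*-identityˡ _ ⟩
  2 ^ n ∎
  where open ≡-Reasoning

-- Counting over Fin m

sum-const : ∀ m k → sum {m} (λ _ → k) ≡ m * k
sum-const zero    k = refl
sum-const (suc m) k = cong (k +_) (sum-const m k)

sum-single : ∀ {m} (f : Fin m → ℕ) i → f i ≡ 1 → (∀ j → j ≢ i → f j ≡ 0) → sum f ≡ 1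
sum-single {suc m} f zero    fi≡1 f≡0 =
  cong₂ _+_ fi≡1 (trans (sum-cong-≗ (λ j → f≡0 (suc j) λ ())) (sum-replicate-zero m))
sum-single {suc m} f (suc i) fi≡1 f≡0 =
  cong₂ _+_ (f≡0 zero λ ()) (sum-single (f ∘ suc) i fi≡1 λ j j≢i → f≡0 (suc j) λ { refl → j≢i refl })

countIf : ∀ {A : Set} → Dec A → ℕ
countIf (yes _) = 1
countIf (no _)  = 0

length-filter-tabulate : ∀ {m} {A : Set} {P : A → Set} (P? : Decidable P) (f : Fin m → A) →
                         length (filter P? (List.tabulate f)) ≡ sum (λ j → countIf (P? (f j)))
length-filter-tabulate {zero}  P? f = refl
length-filter-tabulate {suc m} P? f with P? (f zero)
... | yes _ = cong suc (length-filter-tabulate P? (f ∘ suc))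
... | no _  = length-filter-tabulate P? (f ∘ suc)

-- Supplies a cube outside a given pair, so that the pair is a proper subfamily to which
-- irreducibility applies.
third : ∀ {m} → 2 < m → (p q : Fin m) → ∃ λ r → r ≢ p × r ≢ q
third (s≤s (s≤s (s≤s _))) zero          zero          = suc zero , (λ ()) , (λ ())
third (s≤s (s≤s (s≤s _))) zero          (suc zero)    = suc (suc zero) , (λ ()) , (λ ())
third (s≤s (s≤s (s≤s _))) zero          (suc (suc _)) = suc zero , (λ ()) , (λ ())
third (s≤s (s≤s (s≤s _))) (suc zero)    zero          = suc (suc zero) , (λ ()) , (λ ())
third (s≤s (s≤s (s≤s _))) (suc zero)    (suc _)       = zero , (λ ()) , (λ ())
third (s≤s (s≤s (s≤s _))) (suc (suc _)) zero          = suc zero , (λ ()) , (λ ())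
third (s≤s (s≤s (s≤s _))) (suc (suc _)) (suc _)       = zero , (λ ()) , (λ ())

-- The combinatorics of partitions

module Partition {n} {F : Family n} (part : IsPartition F) where

  m : ℕ
  m = length F

  cube : Fin m → Cube n
  cube = List.lookup F

  owner : Point n → Fin m
  owner x = proj₁ (part x)

  ∈-owner : ∀ x → x ∈ᶜ cube (owner x)
  ∈-owner x = proj₁ (proj₂ (part x))

  cube-unique : ∀ x j k → x ∈ᶜ cube j → x ∈ᶜ cube k → j ≡ k
  cube-unique x j k x∈j x∈k =
    trans (proj₂ (proj₂ (part x)) j x∈j) (sym (proj₂ (proj₂ (part x)) k x∈k))

  ∈-unique : ∀ x s t → s ∈ F → t ∈ F → x ∈ᶜ s → x ∈ᶜ t → s ≡ t
  ∈-unique x s t s∈F t∈F x∈s x∈t =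
    trans s≡ (trans (cong cube (cube-unique x _ _ (subst (x ∈ᶜ_) s≡ x∈s) (subst (x ∈ᶜ_) t≡ x∈t)))
                    (sym t≡))
    where
    s≡ = lookup-index s∈F
    t≡ = lookup-index t∈F

  sum-indᶜ≡1 : ∀ x → sum (λ j → indᶜ x (cube j)) ≡ 1
  sum-indᶜ≡1 x = sum-single _ (owner x) (indᶜ-∈ x _ (∈-owner x))
    λ j j≢ → indᶜ-∉ x _ λ x∈j → j≢ (cube-unique x j (owner x) x∈j (∈-owner x))

  -- If the owner of the flipped point had `⋆` at `i`, it would also contain `x` and so be `cube p`,
  -- which is fixed at `i`. This is the pointwise form of the fact that the cubes with 0 at `i` and
  -- those with 1 have the same projection along `i`.
  twin : ∀ {i b} p x → lookup (cube p) i ≡ bit b → x ∈ᶜ cube p →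
         ∃ λ q → lookup (cube q) i ≡ bit (not b) × (x [ i ]≔ not b) ∈ᶜ cube q
  twin {i} {b} p x eq x∈p with owner (x [ i ]≔ not b) | ∈-owner (x [ i ]≔ not b)
  ... | q | y∈q with ⋆-or-bit (lookup (cube q) i)
  ... | inj₂ (b′ , q≡) = q , trans q≡ (cong bit (sym y≡)) , y∈q
    where
    y≡ : not b ≡ b′
    y≡ = trans (sym (lookup∘update i x (not b))) (∈⇒lookup≡ (x [ i ]≔ not b) (cube q) y∈q q≡)
  ... | inj₁ q≡⋆ = contradiction (trans (sym eq) (trans (cong (λ j → lookup (cube j) i) p≡q) q≡⋆)) (bit≢⋆ b)
    where
    x∈q : x ∈ᶜ cube q
    x∈q = subst (_∈ᶜ cube q)
      (trans ([]≔-idempotent x i) (update-id x (∈⇒lookup≡ x (cube p) x∈p eq)))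
      (∈-update-⋆ (x [ i ]≔ not b) (cube q) b q≡⋆ y∈q)
    p≡q : p ≡ q
    p≡q = cube-unique x p q x∈p x∈q

  -- Volume counts in codimension 3

  module Counting (codim≡3 : ∀ s → s ∈ F → codim s ≡ 3) where

    codim-cube : ∀ j → codim (cube j) ≡ 3
    codim-cube j = codim≡3 (cube j) (∈-lookup j)

    -- Both sides come from counting the points with value `b` at `i`: cube by cube through
    -- `half-volume`, and point by point because each point has exactly one owner.
    sum-weight≡8 : ∀ b i → sum (λ j → weight b (lookup (cube j) i)) ≡ 8
    sum-weight≡8 b i = ℕ.*-cancelʳ-≡ _ _ (2 ^ n) {{ℕ.m^n≢0 2 n}} (begin
      sum (λ j → weight b (lookup (cube j) i)) * 2 ^ n
        ≡⟨ *-distribʳ-sum (2 ^ n) (λ j → weight b (lookup (cube j) i)) ⟩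
      sum (λ j → weight b (lookup (cube j) i) * 2 ^ n)
        -- The 16 is 8 = 2³, from codimension 3, times the factor 2 of `half-volume`.
        ≡⟨ sum-cong-≗ (λ j → trans (sym (half-volume b (cube j) i))
             (trans (cong (λ k → H j * 2 ^ k * 2) (codim-cube j)) (ℕ.*-assoc (H j) 8 2))) ⟩
      sum (λ j → H j * 16)
        ≡⟨ sym (*-distribʳ-sum 16 H) ⟩
      sum H * 16
        ≡⟨ cong (_* 16) (sym (sumPoints-sum n (λ j x → ind (lookup x i) (bit b) * indᶜ x (cube j)))) ⟩
      sumPoints n (λ x → sum (λ j → ind (lookup x i) (bit b) * indᶜ x (cube j))) * 16
        ≡⟨ cong (_* 16) (sumPoints-cong n λ x →
             trans (sym (*-distribˡ-sum (ind (lookup x i) (bit b)) (λ j → indᶜ x (cube j))))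
             (trans (cong (ind (lookup x i) (bit b) *_) (sum-indᶜ≡1 x)) (ℕ.*-identityʳ _))) ⟩
      sumPoints n (λ x → ind (lookup x i) (bit b)) * 16
        ≡⟨ sym (ℕ.*-assoc (sumPoints n (λ x → ind (lookup x i) (bit b))) 2 8) ⟩
      sumPoints n (λ x → ind (lookup x i) (bit b)) * 2 * 8
        ≡⟨ cong (_* 8) (half-volume-⋆ b i) ⟩
      2 ^ n * 8
        ≡⟨ ℕ.*-comm (2 ^ n) 8 ⟩
      8 * 2 ^ n ∎)
      where
      open ≡-Reasoning
      H : Fin m → ℕ
      H j = sumPoints n (λ x → ind (lookup x i) (bit b) * indᶜ x (cube j))

    #_at_ : Sym → Fin n → ℕ
    # c at i = sum (λ j → countIf (lookup (cube j) i ≟ˢ c))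

    positions : Sym → Fin n → List (Fin m)
    positions c i = filter (λ j → lookup (cube j) i ≟ˢ c) (allFin m)

    length-positions : ∀ c i → length (positions c i) ≡ # c at i
    length-positions c i = length-filter-tabulate (λ j → lookup (cube j) i ≟ˢ c) (λ j → j)

    all-positions : ∀ c i → All (λ j → lookup (cube j) i ≡ c) (positions c i)
    all-positions c i = all-filter (λ j → lookup (cube j) i ≟ˢ c) (allFin m)

    unique-positions : ∀ c i → Unique (positions c i)
    unique-positions c i = filter⁺ (λ j → lookup (cube j) i ≟ˢ c) (allFin⁺ m)

    ∈-positions : ∀ {c i} j → lookup (cube j) i ≡ c → j ∈ positions c i
    ∈-positions {c} {i} j = ∈-filter⁺ (λ j → lookup (cube j) i ≟ˢ c) (∈-allFin j)

    weight-count : ∀ b c → weight b c ≡ countIf (c ≟ˢ bit b) + countIf (c ≟ˢ bit b) + countIf (c ≟ˢ ⋆)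
    weight-count false 𝟘 = refl
    weight-count false 𝟙 = refl
    weight-count false ⋆ = refl
    weight-count true  𝟘 = refl
    weight-count true  𝟙 = refl
    weight-count true  ⋆ = refl

    #-weight : ∀ b i → # bit b at i + # bit b at i + # ⋆ at i ≡ 8
    #-weight b i = trans
      (sym (trans (sum-cong-≗ λ j → weight-count b (lookup (cube j) i))
           (trans (∑-distrib-+ (λ j → countIf (lookup (cube j) i ≟ˢ bit b) + countIf (lookup (cube j) i ≟ˢ bit b)) _)
                  (cong (_+ # ⋆ at i) (∑-distrib-+ (λ j → countIf (lookup (cube j) i ≟ˢ bit b)) _)))))
      (sum-weight≡8 b i)

    #𝟘≡#𝟙 : ∀ i → # 𝟘 at i ≡ # 𝟙 at i
    #𝟘≡#𝟙 i = halve (ℕ.+-cancelʳ-≡ (# ⋆ at i) _ _ (trans (#-weight false i) (sym (#-weight true i))))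
      where
      halve : ∀ {u v} → u + u ≡ v + v → u ≡ v
      halve {u} {v} eq = ℕ.*-cancelˡ-≡ u v 2
        (trans (cong (u +_) (ℕ.+-identityʳ u)) (trans eq (cong (v +_) (sym (ℕ.+-identityʳ v)))))

    #𝟘≤4 : ∀ i → # 𝟘 at i ≤ 4
    #𝟘≤4 i = ℕ.*-cancelˡ-≤ 2 (ℕ.≤-trans
      (ℕ.≤-reflexive (cong (# 𝟘 at i +_) (ℕ.+-identityʳ _)))
      (ℕ.m+n≤o⇒m≤o _ (ℕ.≤-reflexive (#-weight false i))))

    weights-sum : ∀ c → weight false c + weight true c ≡ 2
    weights-sum 𝟘 = refl
    weights-sum 𝟙 = refl
    weights-sum ⋆ = refl

    -- The two sides of coordinate `i` give each cube total weight 2, while each side carries weight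
    -- 8 in all.
    m≡8 : Fin n → m ≡ 8
    m≡8 i = ℕ.*-cancelʳ-≡ m 8 2 (begin
      m * 2                ≡⟨ sym (sum-const m 2) ⟩
      sum {m} (λ _ → 2)    ≡⟨ sum-cong-≗ {m} (λ j → sym (weights-sum (lookup (cube j) i))) ⟩
      sum (λ j → weight false (lookup (cube j) i) + weight true (lookup (cube j) i))
                           ≡⟨ ∑-distrib-+ (λ j → weight false (lookup (cube j) i)) _ ⟩
      sum (λ j → weight false (lookup (cube j) i)) + sum (λ j → weight true (lookup (cube j) i))
                           ≡⟨ cong₂ _+_ (sum-weight≡8 false i) (sum-weight≡8 true i) ⟩
      16                   ∎)
      where open ≡-Reasoning

  -- Unions excluded by irreducibility

  module Merging (irr : Irreducible F) where

    -- Irreducibility for a subfamily given by a decidable predicate. The distinct members `p` and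
    -- `q` witness that it has more than one cube, the non-member `r` that it is not the whole
    -- family.
    no-proper-union : ∀ {P : Fin m → Set} (P? : Decidable P) {p q r} → p ≢ q → P p → P q → ¬ P r →
      (s : Cube n) → (∀ x → x ∈ᶜ s → ∃ λ j → P j × x ∈ᶜ cube j) →
      (∀ j → P j → ∀ x → x ∈ᶜ cube j → x ∈ᶜ s) → ⊥
    no-proper-union {P} P? {p} {q} {r} p≢q Pp Pq ¬Pr s s⊆ ⊆s = irr G 1<∣G∣ ∣G∣<m
      (s , λ x → mk⇔
        (λ x∈s → let j , Pj , x∈j = s⊆ x x∈s in j , ∈G⁺ Pj , x∈j)
        (λ (j , j∈G , x∈j) → ⊆s j (∈G⁻ j∈G) x x∈j))
      where
      G : Subset m
      G = tabulate (does ∘ P?)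
      ∈G⁺ : ∀ {j} → P j → j ∈ˢ G
      ∈G⁺ {j} Pj = lookup⇒[]= j G (trans (lookup∘tabulate (does ∘ P?) j) (dec-true (P? j) Pj))
      ∈G⁻ : ∀ {j} → j ∈ˢ G → P j
      ∈G⁻ {j} j∈G with P? j | trans (sym (lookup∘tabulate (does ∘ P?) j)) ([]=⇒lookup j∈G)
      ... | yes Pj | _ = Pj
      ... | no _   | ()
      1<∣G∣ : 1 < ∣ G ∣
      1<∣G∣ = subst (_< ∣ G ∣) (∣⁅x⁆∣≡1 p) (p⊂q⇒∣p∣<∣q∣
        ( (λ j∈ → subst (_∈ˢ G) (sym (x∈⁅y⁆⇒x≡y p j∈)) (∈G⁺ Pp))
        , q , ∈G⁺ Pq , λ q∈ → p≢q (sym (x∈⁅y⁆⇒x≡y p q∈))))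
      ∣G∣<m : ∣ G ∣ < m
      ∣G∣<m = subst (∣ G ∣ <_) (∣⊤∣≡n m) (p⊂q⇒∣p∣<∣q∣
        ((λ _ → ∈⊤) , r , ∈⊤ , ¬Pr ∘ ∈G⁻))

    -- The two cubes are translates of each other along `i`, so their union is `cube p` with
    -- coordinate `i` freed, and a third cube makes the pair a proper subfamily.
    no-mergeable : 2 < m → ∀ {p q i b} →
      lookup (cube p) i ≡ bit b → lookup (cube q) i ≡ bit (not b) →
      (∀ x → x ∈ᶜ cube p → (x [ i ]≔ not b) ∈ᶜ cube q) →
      (∀ x → x ∈ᶜ cube q → (x [ i ]≔ b) ∈ᶜ cube p) → ⊥
    no-mergeable 2<m {p} {q} {i} {b} p≡ q≡ p⇒q q⇒p
      with r , r≢p , r≢q ← third 2<m p q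
      = no-proper-union (λ j → (j ≟ p) ⊎-dec (j ≟ q)) p≢q (inj₁ refl) (inj₂ refl)
          [ r≢p , r≢q ]′ s s⊆ ⊆s
      where
      s = cube p [ i ]≔ ⋆
      p≢q : p ≢ q
      p≢q refl = contradiction (bit-injective _ _ (trans (sym p≡) q≡)) (not-¬ refl)
      s⊆ : ∀ x → x ∈ᶜ s → ∃ λ j → (j ≡ p ⊎ j ≡ q) × x ∈ᶜ cube j
      -- Setting coordinate `i` to `b` moves `x` into `cube p`; the actual bit of `x` at `i` decides
      -- whether `x` itself lies in `cube p` or in its translate.
      s⊆ x x∈s with y∈p ← ∈-widen-fix x (cube p) p≡ x∈s | b Bool.≟ lookup x i
      ... | yes b≡ = p , inj₁ refl , subst (_∈ᶜ cube p) (update-id x (sym b≡)) y∈p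
      ... | no b≢  = q , inj₂ refl , subst (_∈ᶜ cube q)
        (trans ([]≔-idempotent x i) (update-id x (≢⇒≡not _ _ b≢))) (p⇒q (x [ i ]≔ b) y∈p)
      ⊆s : ∀ j → j ≡ p ⊎ j ≡ q → ∀ x → x ∈ᶜ cube j → x ∈ᶜ s
      ⊆s j (inj₁ refl) x x∈p = ∈-widen x (cube p) i x∈p
      ⊆s j (inj₂ refl) x x∈q = ∈-widen-unfix x (cube p) (q⇒p x x∈q)

    -- Without `⋆` at `i`, the cubes with `𝟘` there fill exactly the half-cube where coordinate `i`
    -- is 0. They are at least two, and `r` is not among them.
    ⋆-occurs : ∀ {i p p′} → p ≢ p′ → lookup (cube p) i ≡ 𝟘 → lookup (cube p′) i ≡ 𝟘 →
             ∀ {r} → lookup (cube r) i ≡ 𝟙 → (∀ j → lookup (cube j) i ≢ ⋆) → ⊥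
    ⋆-occurs {i} p≢p′ p≡𝟘 p′≡𝟘 r≡𝟙 no-⋆ =
      no-proper-union (λ j → lookup (cube j) i ≟ˢ 𝟘) p≢p′ p≡𝟘 p′≡𝟘
        (λ r≡𝟘 → contradiction (trans (sym r≡𝟘) r≡𝟙) λ ()) s s⊆ ⊆s
      where
      s = replicate n ⋆ [ i ]≔ 𝟘
      s≡ : lookup s i ≡ 𝟘
      s≡ = lookup∘update i (replicate n ⋆) 𝟘
      s⊆ : ∀ x → x ∈ᶜ s → ∃ λ j → lookup (cube j) i ≡ 𝟘 × x ∈ᶜ cube j
      s⊆ x x∈s with ⋆-or-bit (lookup (cube (owner x)) i)
      ... | inj₁ eq = contradiction eq (no-⋆ (owner x))
      ... | inj₂ (b , eq) = owner x , trans eq (cong bit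
        (trans (sym (∈⇒lookup≡ x (cube (owner x)) (∈-owner x) eq)) (∈⇒lookup≡ x s x∈s s≡))) , ∈-owner x
      ⊆s : ∀ j → lookup (cube j) i ≡ 𝟘 → ∀ x → x ∈ᶜ cube j → x ∈ᶜ s
      ⊆s j j≡𝟘 x x∈j = subst (_∈ᶜ s) (update-id x (∈⇒lookup≡ x (cube j) x∈j j≡𝟘))
        (∈-update₂ x (replicate n ⋆) (∈-replicate-⋆ x) tt)

-- Coordinate counts in irreducible partitions of codimension 3

module Homogeneous₃ {n} {F : Family n} (hom : Homogeneous n 3 F) (irr : Irreducible F) where

  open Partition {F = F} (proj₁ hom)
  open Counting (proj₂ (proj₂ hom))
  open Merging irr

  -- A cube of codimension 3 has at least one position. This provides the coordinate along which
  -- `m≡8` counts.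
  some-coordinate : Fin n
  some-coordinate with owner (replicate n false)
  ... | p = coordinate (cube p) (codim-cube p)
    where
    coordinate : ∀ {n} (s : Cube n) → codim s ≡ 3 → Fin n
    coordinate (_ ∷ _) _ = zero

  2<m : 2 < m
  2<m = subst (2 <_) (sym (m≡8 some-coordinate)) (s≤s (s≤s (s≤s z≤n)))

  -- Every twin of a point of `cube p` must lie in `cube q` and conversely, so the two cubes are
  -- translates along `i`.
  not-one : ∀ {i p q} → lookup (cube p) i ≡ 𝟘 → lookup (cube q) i ≡ 𝟙 →
            (∀ j → lookup (cube j) i ≡ 𝟘 → j ≡ p) → (∀ j → lookup (cube j) i ≡ 𝟙 → j ≡ q) → ⊥
  not-one {i} {p} {q} p≡𝟘 q≡𝟙 only-p only-q = no-mergeable 2<m p≡𝟘 q≡𝟙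
    (λ x x∈p → let j , j≡𝟙 , y∈j = twin p x p≡𝟘 x∈p in
      subst (λ j → (x [ i ]≔ true) ∈ᶜ cube j) (only-q j j≡𝟙) y∈j)
    (λ x x∈q → let j , j≡𝟘 , y∈j = twin q x q≡𝟙 x∈q in
      subst (λ j → (x [ i ]≔ false) ∈ᶜ cube j) (only-p j j≡𝟘) y∈j)

  module _ {i k : Fin n} (k≢i : k ≢ i) where

    -- The projection of q along i is contained in that of p, hence equal to it as the codimensions agree.
    not-absorbed : ∀ {p p′ q b b′} → b ≢ b′ →
      lookup (cube p) i ≡ 𝟘 → lookup (cube q) i ≡ 𝟙 →
      (∀ j → lookup (cube j) i ≡ 𝟘 → j ≡ p ⊎ j ≡ p′) →
      lookup (cube p′) k ≡ bit b′ → lookup (cube q) k ≡ bit b → ⊥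
    not-absorbed {p} {p′} {q} {b} {b′} b≢b′ p≡𝟘 q≡𝟙 only p′≡b′ q≡b =
      no-mergeable 2<m p≡𝟘 q≡𝟙 p⇒q q⇒p
      where
      q⇒p : ∀ x → x ∈ᶜ cube q → (x [ i ]≔ false) ∈ᶜ cube p
      q⇒p x x∈q with twin q x q≡𝟙 x∈q
      ... | j , j≡𝟘 , y∈j with only j j≡𝟘
      ... | inj₁ refl = y∈j
      -- Moving along `i` leaves coordinate `k` alone, and there `cube q` and `cube p′` have
      -- different bits; hence the twin lies in `cube p`.
      ... | inj₂ refl = contradiction
        (trans (sym (∈⇒lookup≡ x (cube q) x∈q q≡b))
        (trans (sym (lookup∘update′ k≢i x false))
               (∈⇒lookup≡ (x [ i ]≔ false) (cube p′) y∈j p′≡b′)))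
        b≢b′
      q′ : Cube n
      q′ = cube q [ i ]≔ 𝟘
      q≡q′ : cube q ≡ q′ [ i ]≔ 𝟙
      q≡q′ = trans (sym ([]≔-lookup (cube q) i))
        (trans (cong (cube q [ i ]≔_) q≡𝟙) (sym ([]≔-idempotent (cube q) i)))
      q′⊆p : ∀ x → x ∈ᶜ q′ → x ∈ᶜ cube p
      q′⊆p x x∈q′ = subst (_∈ᶜ cube p)
        (trans ([]≔-idempotent x i)
               (update-id x (∈⇒lookup≡ x q′ x∈q′ (lookup∘update i (cube q) 𝟘))))
        (q⇒p (x [ i ]≔ true) (subst ((x [ i ]≔ true) ∈ᶜ_) (sym q≡q′) (∈-update₂ x q′ x∈q′ tt)))
      q′≡p : q′ ≡ cube p
      q′≡p = ⊆∧codim≡⇒≡ q′ (cube p) q′⊆p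
        (trans (codim-update (cube q) true false q≡𝟙) (trans (codim-cube q) (sym (codim-cube p))))
      p⇒q : ∀ x → x ∈ᶜ cube p → (x [ i ]≔ true) ∈ᶜ cube q
      p⇒q x x∈p = subst ((x [ i ]≔ true) ∈ᶜ_) (sym q≡q′)
        (∈-update₂ x q′ (subst (x ∈ᶜ_) (sym q′≡p) x∈p) tt)

    -- The point crosses to the side where coordinate `i` is 1, moves along `k`, which is free in
    -- both cubes `q` and `q′`, and crosses back. Its new bit at `k` keeps it out of `cube p`, so it
    -- lands in `cube p′`.
    slide : ∀ {p p′ q q′ b b′} → b ≢ b′ →
      lookup (cube p) i ≡ 𝟘 → lookup (cube p) k ≡ bit b →
      (∀ j → lookup (cube j) i ≡ 𝟘 → j ≡ p ⊎ j ≡ p′) →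
      (∀ j → lookup (cube j) i ≡ 𝟙 → j ≡ q ⊎ j ≡ q′) →
      lookup (cube q) k ≡ ⋆ → lookup (cube q′) k ≡ ⋆ →
      ∀ x → x ∈ᶜ cube p → (x [ k ]≔ b′) ∈ᶜ cube p′
    slide {p} {p′} {q} {q′} {b} {b′} b≢b′ p≡𝟘 p≡b only-p only-q q≡⋆ q′≡⋆ x x∈p =
      let j , j≡𝟙 , y∈j = twin p x p≡𝟘 x∈p
          z∈j = ∈-update-⋆ (x [ i ]≔ true) (cube j) b′ (j≡⋆ (only-q j j≡𝟙)) y∈j
          l , l≡𝟘 , w∈l = twin j (x [ i ]≔ true [ k ]≔ b′) j≡𝟙 z∈j
      in locate (only-p l l≡𝟘) (subst (_∈ᶜ cube l) w≡ w∈l)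
      where
      j≡⋆ : ∀ {j} → j ≡ q ⊎ j ≡ q′ → lookup (cube j) k ≡ ⋆
      j≡⋆ (inj₁ refl) = q≡⋆
      j≡⋆ (inj₂ refl) = q′≡⋆
      w≡ : x [ i ]≔ true [ k ]≔ b′ [ i ]≔ false ≡ x [ k ]≔ b′
      w≡ = begin
        x [ i ]≔ true [ k ]≔ b′ [ i ]≔ false  ≡⟨ []≔-commutes (x [ i ]≔ true) k i k≢i ⟩
        x [ i ]≔ true [ i ]≔ false [ k ]≔ b′  ≡⟨ cong (_[ k ]≔ b′) ([]≔-idempotent x i) ⟩
        x [ i ]≔ false [ k ]≔ b′              ≡⟨ cong (_[ k ]≔ b′) (update-id x (∈⇒lookup≡ x (cube p) x∈p p≡𝟘)) ⟩
        x [ k ]≔ b′                           ∎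
        where open ≡-Reasoning
      locate : ∀ {l} → l ≡ p ⊎ l ≡ p′ → (x [ k ]≔ b′) ∈ᶜ cube l → (x [ k ]≔ b′) ∈ᶜ cube p′
      locate (inj₁ refl) x′∈p = contradiction
        (trans (sym (∈⇒lookup≡ (x [ k ]≔ b′) (cube p) x′∈p p≡b)) (lookup∘update k x b′)) b≢b′
      locate (inj₂ refl) x′∈p′ = x′∈p′

  not-two : ∀ {i p p′ q q′} → p ≢ p′ →
    lookup (cube p) i ≡ 𝟘 → lookup (cube p′) i ≡ 𝟘 → lookup (cube q) i ≡ 𝟙 → lookup (cube q′) i ≡ 𝟙 →
    (∀ j → lookup (cube j) i ≡ 𝟘 → j ≡ p ⊎ j ≡ p′) →
    (∀ j → lookup (cube j) i ≡ 𝟙 → j ≡ q ⊎ j ≡ q′) → ⊥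
  not-two {i} {p} {p′} {q} {q′} p≢p′ p≡𝟘 p′≡𝟘 q≡𝟙 q′≡𝟙 only-p only-q
    with k , b , p≡b , p′≡b′ ← disjoint⇒clash (cube p) (cube p′)
           (λ (x , x∈p , x∈p′) → p≢p′ (cube-unique x p p′ x∈p x∈p′))
    = go (⋆-or-bit (lookup (cube q) k)) (⋆-or-bit (lookup (cube q′) k))
    where
    k≢i : k ≢ i
    k≢i refl = contradiction
      (trans (bit-injective _ false (trans (sym p≡b) p≡𝟘))
             (sym (bit-injective _ false (trans (sym p′≡b′) p′≡𝟘))))
      (not-¬ refl)
    only-swap : ∀ j → lookup (cube j) i ≡ 𝟘 → j ≡ p′ ⊎ j ≡ p
    only-swap j j≡𝟘 = Sum.swap (only-p j j≡𝟘)
    -- A cube fixed at `k` agrees there with exactly one of `p` and `p′`; the other one cannot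
    -- contain any of its twins, so it merges with the one it agrees with.
    not-fixed : ∀ {r} → lookup (cube r) i ≡ 𝟙 → ∃ (λ b′ → lookup (cube r) k ≡ bit b′) → ⊥
    not-fixed r≡𝟙 (b′ , r≡b′) with b Bool.≟ b′
    ... | yes refl = not-absorbed k≢i (not-¬ refl) p≡𝟘 r≡𝟙 only-p p′≡b′ r≡b′
    ... | no b≢b′  = not-absorbed k≢i (b≢b′ ∘ sym) p′≡𝟘 r≡𝟙 only-swap p≡b r≡b′
    go : lookup (cube q) k ≡ ⋆ ⊎ ∃ (λ b′ → lookup (cube q) k ≡ bit b′) →
         lookup (cube q′) k ≡ ⋆ ⊎ ∃ (λ b′ → lookup (cube q′) k ≡ bit b′) → ⊥
    go (inj₂ q-fixed) _ = not-fixed q≡𝟙 q-fixed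
    go (inj₁ _) (inj₂ q′-fixed) = not-fixed q′≡𝟙 q′-fixed
    go (inj₁ q≡⋆) (inj₁ q′≡⋆) = no-mergeable 2<m p≡b p′≡b′
      (slide k≢i (not-¬ refl) p≡𝟘 p≡b only-p only-q q≡⋆ q′≡⋆)
      (slide k≢i (not-¬ refl ∘ sym) p′≡𝟘 p′≡b′ only-swap only-q q≡⋆ q′≡⋆)

  -- Case distinction on the lists of cubes with `𝟘` and with `𝟙` at `i`, which have the same
  -- length, at most 4. They are arguments of `cases` so that their shapes can be matched along with
  -- the facts about them.
  #𝟘≡3 : ∀ i → # 𝟘 at i ≡ 3
  #𝟘≡3 i = cases (positions 𝟘 i) (positions 𝟙 i) (length-positions 𝟘 i)
    (trans (length-positions 𝟙 i) (sym (#𝟘≡#𝟙 i)))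
    (all-positions 𝟘 i) (unique-positions 𝟘 i) ∈-positions (all-positions 𝟙 i) ∈-positions
    where
    none : ∀ c → # c at i ≡ 0 → ∀ j → lookup (cube j) i ≢ c
    none c #c≡0 j j≡c with positions c i | length-positions c i | ∈-positions j j≡c
    ... | []    | _  | ()
    ... | _ ∷ _ | eq | _ with () ← trans eq #c≡0
    ∈₁ : ∀ {j p : Fin m} → j ∈ p ∷ [] → j ≡ p
    ∈₁ (here eq) = eq
    ∈₂ : ∀ {j p q : Fin m} → j ∈ p ∷ q ∷ [] → j ≡ p ⊎ j ≡ q
    ∈₂ (here eq)         = inj₁ eq
    ∈₂ (there (here eq)) = inj₂ eq
    cases : ∀ zs os → length zs ≡ # 𝟘 at i → length os ≡ # 𝟘 at i →
      All (λ j → lookup (cube j) i ≡ 𝟘) zs → Unique zs → (∀ j → lookup (cube j) i ≡ 𝟘 → j ∈ zs) →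
      All (λ j → lookup (cube j) i ≡ 𝟙) os → (∀ j → lookup (cube j) i ≡ 𝟙 → j ∈ os) → # 𝟘 at i ≡ 3
    -- No `𝟙` occurs at `i` either, so every cube would have `⋆` there, against tightness.
    cases [] _ #zs _ _ _ _ _ _
      with s , s∈F , s≢⋆ ← proj₁ (proj₂ hom) i
      with ⋆-or-bit (lookup s i) | cong (λ s → lookup s i) (lookup-index s∈F)
    ... | inj₁ s≡⋆ | _ = contradiction s≡⋆ s≢⋆
    ... | inj₂ (false , s≡) | eq = ⊥-elim (none 𝟘 (sym #zs) _ (trans (sym eq) s≡))
    ... | inj₂ (true , s≡) | eq = ⊥-elim (none 𝟙 (trans (sym (#𝟘≡#𝟙 i)) (sym #zs)) _ (trans (sym eq) s≡))
    cases (p ∷ []) (q ∷ []) _ _ (p≡𝟘 ∷ []) _ ∈zs (q≡𝟙 ∷ []) ∈os =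
      ⊥-elim (not-one p≡𝟘 q≡𝟙 (λ j → ∈₁ ∘ ∈zs j) (λ j → ∈₁ ∘ ∈os j))
    cases (p ∷ p′ ∷ []) (q ∷ q′ ∷ []) _ _ (p≡𝟘 ∷ p′≡𝟘 ∷ []) ((p≢p′ ∷ []) ∷ _) ∈zs (q≡𝟙 ∷ q′≡𝟙 ∷ []) ∈os =
      ⊥-elim (not-two p≢p′ p≡𝟘 p′≡𝟘 q≡𝟙 q′≡𝟙 (λ j → ∈₂ ∘ ∈zs j) (λ j → ∈₂ ∘ ∈os j))
    cases (_ ∷ _ ∷ _ ∷ []) _ #zs _ _ _ _ _ _ = sym #zs
    -- Four zeros already account for the total weight 8, which leaves no cube with `⋆` at `i`.
    cases (p ∷ p′ ∷ _ ∷ _ ∷ []) (r ∷ _) #zs _ (p≡𝟘 ∷ p′≡𝟘 ∷ _) ((p≢p′ ∷ _) ∷ _) _ (r≡𝟙 ∷ _) _ =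
      ⊥-elim (⋆-occurs p≢p′ p≡𝟘 p′≡𝟘 r≡𝟙 (none ⋆
        (ℕ.+-cancelˡ-≡ 8 _ 0 (trans (cong (λ z → z + z + # ⋆ at i) #zs) (#-weight false i)))))
    cases (_ ∷ _ ∷ _ ∷ _ ∷ _ ∷ _) _ #zs _ _ _ _ _ _ =
      contradiction (subst (_≤ 4) (sym #zs) (#𝟘≤4 i)) λ { (s≤s (s≤s (s≤s (s≤s ())))) }
    -- The remaining shapes have lists of different lengths.
    cases (_ ∷ _) [] #zs #os _ _ _ _ _ with () ← trans #zs (sym #os)
    cases (_ ∷ []) (_ ∷ _ ∷ _) #zs #os _ _ _ _ _ with () ← trans #zs (sym #os)
    cases (_ ∷ _ ∷ []) (_ ∷ []) #zs #os _ _ _ _ _ with () ← trans #zs (sym #os)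
    cases (_ ∷ _ ∷ []) (_ ∷ _ ∷ _ ∷ _) #zs #os _ _ _ _ _ with () ← trans #zs (sym #os)

  fixes≡countIf : ∀ c → fixes c ≡ countIf (c ≟ˢ 𝟘) + countIf (c ≟ˢ 𝟙)
  fixes≡countIf 𝟘 = refl
  fixes≡countIf 𝟙 = refl
  fixes≡countIf ⋆ = refl

  -- The fixed entries of all cubes are counted twice: six for each coordinate, three for each of
  -- the eight cubes.
  n≡4 : n ≡ 4
  n≡4 = ℕ.*-cancelʳ-≡ n 4 6 (begin
    n * 6                       ≡⟨ sym (sum-const n 6) ⟩
    sum {n} (λ _ → 6)           ≡⟨ sum-cong-≗ {n} (λ i → sym (sum-fixes≡6 i)) ⟩
    sum (λ i → sum (λ j → fixes (lookup (cube j) i)))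
                                ≡⟨ ∑-comm (λ i j → fixes (lookup (cube j) i)) ⟩
    sum (λ j → sum (λ i → fixes (lookup (cube j) i)))
                                ≡⟨ sum-cong-≗ (λ j → trans (sym (codim≡sum (cube j))) (codim-cube j)) ⟩
    sum {m} (λ _ → 3)           ≡⟨ sum-const m 3 ⟩
    m * 3                       ≡⟨ cong (_* 3) (m≡8 some-coordinate) ⟩
    24                          ∎)
    where
    open ≡-Reasoning
    sum-fixes≡6 : ∀ i → sum (λ j → fixes (lookup (cube j) i)) ≡ 6
    sum-fixes≡6 i = trans (sum-cong-≗ λ j → fixes≡countIf (lookup (cube j) i))
      (trans (∑-distrib-+ (λ j → countIf (lookup (cube j) i ≟ˢ 𝟘)) _)
             (cong₂ _+_ (#𝟘≡3 i) (trans (sym (#𝟘≡#𝟙 i)) (#𝟘≡3 i))))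

-- Enumerations

points : ∀ n → List (Point n)
points zero    = [] ∷ []
points (suc n) = map (false ∷_) (points n) ++ map (true ∷_) (points n)

∈-points : ∀ {n} (x : Point n) → x ∈ points n
∈-points []                = here refl
∈-points {suc n} (false ∷ x) = ∈-++⁺ˡ (∈-map⁺ (false ∷_) (∈-points x))
∈-points {suc n} (true ∷ x)  = ∈-++⁺ʳ (map (false ∷_) (points n)) (∈-map⁺ (true ∷_) (∈-points x))

cubes : ∀ n → List (Cube n)
cubes zero    = [] ∷ []
cubes (suc n) = map (𝟘 ∷_) (cubes n) ++ map (𝟙 ∷_) (cubes n) ++ map (⋆ ∷_) (cubes n)

∈-cubes : ∀ {n} (s : Cube n) → s ∈ cubes n
∈-cubes []              = here refl
∈-cubes {suc n} (𝟘 ∷ s) = ∈-++⁺ˡ (∈-map⁺ (𝟘 ∷_) (∈-cubes s))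
∈-cubes {suc n} (𝟙 ∷ s) = ∈-++⁺ʳ (map (𝟘 ∷_) (cubes n)) (∈-++⁺ˡ (∈-map⁺ (𝟙 ∷_) (∈-cubes s)))
∈-cubes {suc n} (⋆ ∷ s) =
  ∈-++⁺ʳ (map (𝟘 ∷_) (cubes n)) (∈-++⁺ʳ (map (𝟙 ∷_) (cubes n)) (∈-map⁺ (⋆ ∷_) (∈-cubes s)))

-- A subcube through `x` is determined by its set of fixed coordinates, so the search has only four
-- candidates at each point when `n` is 4 and `k` is 3.
cubesAt : ∀ {n} → Point n → ℕ → List (Cube n)
cubesAt []      zero    = [] ∷ []
cubesAt []      (suc _) = []
cubesAt (b ∷ x) zero    = map (⋆ ∷_) (cubesAt x 0)
cubesAt (b ∷ x) (suc k) = map (⋆ ∷_) (cubesAt x (suc k)) ++ map (bit b ∷_) (cubesAt x k)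

∈-cubesAt : ∀ {n} (x : Point n) s k → x ∈ᶜ s → codim s ≡ k → s ∈ cubesAt x k
∈-cubesAt []          []      zero    _   _  = here refl
∈-cubesAt (b ∷ x)     (⋆ ∷ s) zero    x∈s eq = ∈-map⁺ (⋆ ∷_) (∈-cubesAt x s 0 (x∈s ∘ suc) eq)
∈-cubesAt (b ∷ x)     (⋆ ∷ s) (suc k) x∈s eq = ∈-++⁺ˡ (∈-map⁺ (⋆ ∷_) (∈-cubesAt x s (suc k) (x∈s ∘ suc) eq))
∈-cubesAt (false ∷ x) (𝟘 ∷ s) (suc k) x∈s eq =
  ∈-++⁺ʳ (map (⋆ ∷_) (cubesAt x (suc k))) (∈-map⁺ (𝟘 ∷_) (∈-cubesAt x s k (x∈s ∘ suc) (ℕ.suc-injective eq)))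
∈-cubesAt (true ∷ x)  (𝟙 ∷ s) (suc k) x∈s eq =
  ∈-++⁺ʳ (map (⋆ ∷_) (cubesAt x (suc k))) (∈-map⁺ (𝟙 ∷_) (∈-cubesAt x s k (x∈s ∘ suc) (ℕ.suc-injective eq)))
∈-cubesAt (true ∷ x)  (𝟘 ∷ s) (suc k) x∈s eq = ⊥-elim (x∈s zero)
∈-cubesAt (false ∷ x) (𝟙 ∷ s) (suc k) x∈s eq = ⊥-elim (x∈s zero)

infix 4 _≟ᶜ_

_≟ᶜ_ : ∀ {n} (s t : Cube n) → Dec (s ≡ t)
_≟ᶜ_ = ≡-dec _≟ˢ_

_∈ᶠ?_ : ∀ {n} (s : Cube n) (L : Family n) → Dec (s ∈ L)
s ∈ᶠ? L = Any.any? (s ≟ᶜ_) L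

-- The irreducible partition of the 4-cube

-- The cubes are edges, two antipodal ones in each of the four directions. Cyclic permutations of
-- the last three coordinates preserve the family.
F₄ : Family 4
F₄ = (⋆ ∷ 𝟘 ∷ 𝟘 ∷ 𝟘 ∷ []) ∷ (⋆ ∷ 𝟙 ∷ 𝟙 ∷ 𝟙 ∷ []) ∷ (𝟘 ∷ ⋆ ∷ 𝟘 ∷ 𝟙 ∷ []) ∷ (𝟙 ∷ ⋆ ∷ 𝟙 ∷ 𝟘 ∷ [])
   ∷ (𝟘 ∷ 𝟙 ∷ ⋆ ∷ 𝟘 ∷ []) ∷ (𝟙 ∷ 𝟘 ∷ ⋆ ∷ 𝟙 ∷ []) ∷ (𝟘 ∷ 𝟘 ∷ 𝟙 ∷ ⋆ ∷ []) ∷ (𝟙 ∷ 𝟙 ∷ 𝟘 ∷ ⋆ ∷ []) ∷ []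

F₄-partition : IsPartition F₄
F₄-partition x = All.lookup (toWitness {a? = All.all? cell? (points 4)} tt) (∈-points x)
  where
  cell? : ∀ (x : Point 4) → Dec (Σ (Fin 8) λ i → (x ∈ᶜ List.lookup F₄ i) × (∀ j → x ∈ᶜ List.lookup F₄ j → j ≡ i))
  cell? x = any? λ i → x ∈? List.lookup F₄ i ×-dec all? λ j → x ∈? List.lookup F₄ j →-dec j ≟ i

F₄-tight : Tight F₄
F₄-tight i = find (toWitness {a? = all? λ i → Any.any? (λ s → ¬? (lookup s i ≟ˢ ⋆)) F₄} tt i)

F₄-codim : ∀ s → s ∈ F₄ → codim s ≡ 3
F₄-codim s = All.lookup (toWitness {a? = All.all? (λ s → codim s ℕ.≟ 3) F₄} tt)

F₄-homogeneous : Homogeneous 4 3 F₄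
F₄-homogeneous = F₄-partition , F₄-tight , F₄-codim

-- A union of cubes of a partition never cuts a cube.
Cuts : ∀ {n} → Cube n → Cube n → Set
Cuts {n} s t = Any (λ x → x ∈ᶜ t × x ∈ᶜ s) (points n) × Any (λ x → x ∈ᶜ t × ¬ x ∈ᶜ s) (points n)

-- When this holds for every `s`, the only subcubes that cut no member of `F` are the whole cube and
-- the members themselves.
Uncut : ∀ {n} → Family n → Cube n → Set
Uncut F s = Any (Cuts s) F ⊎ (∀ i → lookup s i ≡ ⋆) ⊎ s ∈ F

uncut? : ∀ {n} (F : Family n) (s : Cube n) → Dec (Uncut F s)
uncut? {n} F s =
  Any.any? (λ t → Any.any? (λ x → x ∈? t ×-dec x ∈? s) (points n)
            ×-dec Any.any? (λ x → x ∈? t ×-dec ¬? (x ∈? s)) (points n)) F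
  ⊎-dec all? (λ i → lookup s i ≟ˢ ⋆)
  ⊎-dec s ∈ᶠ? F

-- A union `s` of members contains every member that it meets, so it cuts none. If `s` is the whole
-- cube then `G` is everything, and if `s` is a member then `G` contains nothing else; either
-- contradicts the bounds on the size of `G`.
uncut⇒irreducible : ∀ {n} {F : Family n} → IsPartition F → (∀ s → Uncut F s) → Irreducible F
uncut⇒irreducible {F = F} part uncut G 1<∣G∣ ∣G∣<m (s , union) = go (uncut s)
  where
  open Partition {F = F} part
  ∈G : ∀ j x → x ∈ᶜ cube j → x ∈ᶜ s → j ∈ˢ G
  ∈G j x x∈j x∈s with k , k∈G , x∈k ← Equivalence.to (union x) x∈s =
    subst (_∈ˢ G) (cube-unique x k j x∈k x∈j) k∈G
  go : Uncut F s → ⊥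
  go (inj₁ cut) with t , t∈F , meets , leaves ← find cut
    with x , _ , x∈t , x∈s ← find meets | y , _ , y∈t , y∉s ← find leaves =
    y∉s (Equivalence.from (union y)
      (j , ∈G j x (subst (x ∈ᶜ_) t≡ x∈t) x∈s , subst (y ∈ᶜ_) t≡ y∈t))
    where
    j = Any.index t∈F
    t≡ = lookup-index t∈F
  go (inj₂ (inj₁ all-⋆)) = ℕ.<⇒≱ ∣G∣<m
    (subst (_≤ ∣ G ∣) (∣⊤∣≡n m) (p⊆q⇒∣p∣≤∣q∣ {p = ⊤ˢ} {q = G} λ {j} _ → j∈G j))
    where
    j∈G : ∀ j → j ∈ˢ G
    j∈G j with x , x∈j ← ∃-∈ (cube j) =
      ∈G j x x∈j (λ i → subst (lookup x i ≼_) (sym (all-⋆ i)) (≼-⋆ _))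
  go (inj₂ (inj₂ s∈F)) = ℕ.<⇒≱ 1<∣G∣
    (subst (∣ G ∣ ≤_) (∣⁅x⁆∣≡1 j) (p⊆q⇒∣p∣≤∣q∣ {p = G} {q = ⁅ j ⁆} λ {k} → G⊆j k))
    where
    j = Any.index s∈F
    G⊆j : ∀ k → k ∈ˢ G → k ∈ˢ ⁅ j ⁆
    G⊆j k k∈G with x , x∈k ← ∃-∈ (cube k) =
      subst (_∈ˢ ⁅ j ⁆)
        (cube-unique x j k
          (subst (x ∈ᶜ_) (lookup-index s∈F) (Equivalence.from (union x) (k , k∈G , x∈k))) x∈k)
        (x∈⁅x⁆ j)

F₄-irreducible : Irreducible F₄
F₄-irreducible = uncut⇒irreducible {F = F₄} F₄-partition
  λ s → All.lookup (toWitness {a? = All.all? (uncut? F₄) (cubes 4)} tt) (∈-cubes s)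

-- Exhaustive search for irreducible partitions

-- Such cubes are the two halves of a subcube of one dimension more. The bit is sought in an
-- explicit list to keep the relation decidable.
Adjacent : ∀ {n} → Cube n → Cube n → Set
Adjacent s t = ∃ λ i →
  Any (λ b → lookup s i ≡ bit b × lookup t i ≡ bit (not b)) (false ∷ true ∷ []) × s [ i ]≔ ⋆ ≡ t [ i ]≔ ⋆

Conflict : ∀ {n} → Cube n → Cube n → Set
Conflict s t = Meets s t ⊎ Adjacent s t

conflict? : ∀ {n} (s t : Cube n) → Dec (Conflict s t)
conflict? s t = meets? s t ⊎-dec any? λ i →
  Any.any? (λ b → lookup s i ≟ˢ bit b ×-dec lookup t i ≟ˢ bit (not b)) (false ∷ true ∷ [])
  ×-dec s [ i ]≔ ⋆ ≟ᶜ t [ i ]≔ ⋆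

-- Every irreducible partition into subcubes of codimension k that extends L satisfies Q, provided L
-- covers all points outside xs.
Search : ∀ {n} → ℕ → (Family n → Set) → List (Point n) → Family n → Set
Search k Q []       L = Q L
Search k Q (x ∷ xs) L =
  (Any (x ∈ᶜ_) L × Search k Q xs L) ⊎
  (¬ Any (x ∈ᶜ_) L × All (λ s → Any (Conflict s) L ⊎ Search k Q xs (s ∷ L)) (cubesAt x k))

search? : ∀ {n} k {Q : Family n → Set} → Decidable Q → ∀ xs L → Dec (Search k Q xs L)
search? k Q? []       L = Q? L
search? k Q? (x ∷ xs) L =
  (Any.any? (x ∈?_) L ×-dec search? k Q? xs L) ⊎-dec
  (¬? (Any.any? (x ∈?_) L) ×-dec
   All.all? (λ s → Any.any? (conflict? s) L ⊎-dec search? k Q? xs (s ∷ L)) (cubesAt x k))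

module _ {n k} {F : Family n} (part : IsPartition F) (codim≡k : ∀ s → s ∈ F → codim s ≡ k)
         (irr : Irreducible F) (2<∣F∣ : 2 < length F) where

  open Partition {F = F} part
  open Merging irr

  ∈-adjacent : ∀ {s t : Cube n} {i b} x → s [ i ]≔ ⋆ ≡ t [ i ]≔ ⋆ → lookup t i ≡ bit b → x ∈ᶜ s → (x [ i ]≔ b) ∈ᶜ t
  ∈-adjacent {s} {t} {i} {b} x eq t≡b x∈s =
    ∈-widen-fix x t t≡b (subst (x ∈ᶜ_) eq (∈-widen x s i x∈s))

  -- A common point would have two owners, and adjacent cubes merge, which irreducibility forbids in
  -- a family of more than two cubes.
  no-conflict : ∀ {s t} → s ∈ F → t ∈ F → s ≢ t → ¬ Conflict s t
  no-conflict {s} {t} s∈F t∈F s≢t (inj₁ (x , x∈s , x∈t)) =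
    s≢t (∈-unique x s t s∈F t∈F x∈s x∈t)
  no-conflict {s} {t} s∈F t∈F s≢t (inj₂ (i , bits , eq)) with b , _ , s≡b , t≡b ← find bits
    with s≡ ← lookup-index s∈F | t≡ ← lookup-index t∈F =
    no-mergeable 2<∣F∣ {p = Any.index s∈F} {q = Any.index t∈F}
      (subst (λ s → lookup s i ≡ bit b) s≡ s≡b) (subst (λ t → lookup t i ≡ bit (not b)) t≡ t≡b)
      (λ x x∈s → subst ((x [ i ]≔ not b) ∈ᶜ_) t≡ (∈-adjacent {s} {t} x eq t≡b (subst (x ∈ᶜ_) (sym s≡) x∈s)))
      (λ x x∈t → subst ((x [ i ]≔ b) ∈ᶜ_) s≡ (∈-adjacent {t} {s} x (sym eq) s≡b (subst (x ∈ᶜ_) (sym t≡) x∈t)))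

  -- The partition `F` itself selects a branch: each uncovered point is covered by its owner. Then
  -- `L` stays inside `F`, so this branch is never discarded by a conflict, and at its leaf `L` has
  -- the same members as `F`.
  search-sound : ∀ {Q : Family n → Set} xs L → Search k Q xs L → (∀ s → s ∈ L → s ∈ F) →
                 (∀ x → x ∈ xs ⊎ Any (x ∈ᶜ_) L) → ∃ λ L′ → Q L′ × (∀ s → s ∈ L′ ⇔ s ∈ F)
  search-sound [] L q L⊆F covered = L , q , λ s → mk⇔ (L⊆F s) (F⊆L s)
    where
    F⊆L : ∀ s → s ∈ F → s ∈ L
    -- Every point is covered at a leaf, so some `t` in `L` shares a point with `s`; both belong to
    -- the partition and therefore coincide.
    F⊆L s s∈F with x , x∈s ← ∃-∈ s with covered x
    ... | inj₂ x∈L with t , t∈L , x∈t ← find x∈L =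
      subst (_∈ L) (∈-unique x t s (L⊆F t t∈L) s∈F x∈t x∈s) t∈L
  search-sound (x ∷ xs) L (inj₁ (x∈L , next)) L⊆F covered = search-sound xs L next L⊆F covered′
    where
    covered′ : ∀ y → y ∈ xs ⊎ Any (y ∈ᶜ_) L
    covered′ y with covered y
    ... | inj₁ (here refl)  = inj₂ x∈L
    ... | inj₁ (there y∈xs) = inj₁ y∈xs
    ... | inj₂ y∈L          = inj₂ y∈L
  search-sound (x ∷ xs) L (inj₂ (x∉L , branches)) L⊆F covered
    with All.lookup branches (∈-cubesAt x s _ (∈-owner x) (codim≡k s s∈F))
    where
    s = cube (owner x)
    s∈F = ∈-lookup {xs = F} (owner x)
  -- The owner differs from every cube of `L`, because it contains `x` and they do not.
  ... | inj₁ conflict with t , t∈L , c ← find conflict =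
    ⊥-elim (no-conflict (∈-lookup {xs = F} (owner x)) (L⊆F t t∈L)
      (λ s≡t → x∉L (lose t∈L (subst (x ∈ᶜ_) s≡t (∈-owner x)))) c)
  ... | inj₂ next = search-sound xs (cube (owner x) ∷ L) next L⊆F′ covered′
    where
    L⊆F′ : ∀ t → t ∈ cube (owner x) ∷ L → t ∈ F
    L⊆F′ t (here refl) = ∈-lookup {xs = F} (owner x)
    L⊆F′ t (there t∈L) = L⊆F t t∈L
    covered′ : ∀ y → y ∈ xs ⊎ Any (y ∈ᶜ_) (cube (owner x) ∷ L)
    covered′ y with covered y
    ... | inj₁ (here refl)  = inj₂ (here (∈-owner x))
    ... | inj₁ (there y∈xs) = inj₁ y∈xs
    ... | inj₂ y∈L          = inj₂ (there y∈L)

-- Flips and uniqueness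

-- The permutation is the identity: flips alone relate any two irreducible (4,3)-homogeneous
-- partitions.
flip : ∀ {n} → Vec Bool n → Cube n → Cube n
flip = act idₚ

flipSym-xor : ∀ a b c → flipSym b (flipSym a c) ≡ flipSym (b xor a) c
flipSym-xor false false c = refl
flipSym-xor true  false c = refl
flipSym-xor false true  c = refl
flipSym-xor true  true  𝟘 = refl
flipSym-xor true  true  𝟙 = refl
flipSym-xor true  true  ⋆ = refl

flipSym-involutive : ∀ b c → flipSym b (flipSym b c) ≡ c
flipSym-involutive false c = refl
flipSym-involutive true  𝟘 = refl
flipSym-involutive true  𝟙 = refl
flipSym-involutive true  ⋆ = refl

flip-xor : ∀ {n} (f g : Vec Bool n) s → flip g (flip f s) ≡ flip (zipWith _xor_ g f) s
flip-xor f g s = tabulate-cong λ i →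
  trans (cong (flipSym (lookup g i)) (lookup∘tabulate _ i))
  (trans (flipSym-xor (lookup f i) (lookup g i) (lookup s i))
         (cong (λ b → flipSym b (lookup s i)) (sym (lookup-zipWith _xor_ i g f))))

flip-involutive : ∀ {n} (f : Vec Bool n) s → flip f (flip f s) ≡ s
flip-involutive f s = trans
  (tabulate-cong λ i → trans (cong (flipSym (lookup f i)) (lookup∘tabulate _ i))
                             (flipSym-involutive (lookup f i) (lookup s i)))
  (tabulate∘lookup s)

-- Equality of sets of cubes, as two decidable inclusions. A flip vector is a Boolean vector like a
-- point, so `points n` enumerates all flips.
FlipOf : ∀ {n} → Family n → Family n → Set
FlipOf {n} F L = Any (λ f → All (_∈ L) (map (flip f) F) × All (_∈ map (flip f) F) L) (points n)

flipOf? : ∀ {n} (F : Family n) → Decidable (FlipOf F)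
flipOf? {n} F L = Any.any?
  (λ f → All.all? (_∈ᶠ? L) (map (flip f) F) ×-dec All.all? (_∈ᶠ? map (flip f) F) L) (points n)

FlippedInto : ∀ {n} → Family n → Family n → Set
FlippedInto {n} B F = Σ (Vec Bool n) λ f → ∀ s → s ∈ F ⇔ s ∈ map (flip f) B

flipOf⇒flippedInto : ∀ {n} {B F : Family n} → (∃ λ L → FlipOf B L × (∀ s → s ∈ L ⇔ s ∈ F)) → FlippedInto B F
flipOf⇒flippedInto (L , flipOf , L⇔F) with f , _ , B⊆L , L⊆B ← find flipOf =
  f , λ s → mk⇔ (All.lookup L⊆B ∘ Equivalence.from (L⇔F s)) (Equivalence.to (L⇔F s) ∘ All.lookup B⊆L)

-- Flips are involutions, so `f` leads from `F` back to `B` and `g` from there to `G`; their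
-- composite is the flip by the coordinatewise exclusive or.
flippedInto⇒equivalent : ∀ {n} {B F G : Family n} → FlippedInto B F → FlippedInto B G → Equivalent F G
flippedInto⇒equivalent {n} {B} {F} {G} (f , F⇔) (g , G⇔) = idₚ , h , λ c → mk⇔ (to c) (from c)
  where
  h = zipWith _xor_ g f
  flip-h : ∀ t → flip g t ≡ flip h (flip f t)
  flip-h t = trans (cong (flip g) (sym (flip-involutive f t))) (flip-xor f g (flip f t))
  to : ∀ c → c ∈ G → Σ (Cube n) λ s → s ∈ F × c ≡ flip h s
  to c c∈G with t , t∈B , refl ← ∈-map⁻ (flip g) (Equivalence.to (G⇔ c) c∈G) =
    flip f t , Equivalence.from (F⇔ _) (∈-map⁺ (flip f) t∈B) , flip-h t
  from : ∀ c → Σ (Cube n) (λ s → s ∈ F × c ≡ flip h s) → c ∈ G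
  from c (s , s∈F , refl) with t , t∈B , refl ← ∈-map⁻ (flip f) (Equivalence.to (F⇔ s) s∈F) =
    subst (_∈ G) (flip-h t) (Equivalence.from (G⇔ _) (∈-map⁺ (flip g) t∈B))

-- Settled by evaluating the decision procedure over the 16 points, starting from the empty family.
search-F₄ : Search 3 (FlipOf F₄) (points 4) []
search-F₄ = toWitness {a? = search? 3 {FlipOf F₄} (flipOf? F₄) (points 4) []} tt

F₄-flippedInto : ∀ {F : Family 4} → Homogeneous 4 3 F → Irreducible F → FlippedInto F₄ F
F₄-flippedInto {F} hom irr = flipOf⇒flippedInto {B = F₄} {F = F}
  (search-sound {k = 3} {F = F} (proj₁ hom) (proj₂ (proj₂ hom)) irr
    (Homogeneous₃.2<m {F = F} hom irr) {Q = FlipOf F₄}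
    -- At the root no cube has been chosen and every point is still to be covered.
    (points 4) [] search-F₄ (λ _ ()) (λ x → inj₁ (∈-points x)))

theorem2p60 : ((n : ℕ) (F : Family n) → Homogeneous n 3 F → Irreducible F → n ≡ 4)
    × (Σ (Family 4) λ F → Homogeneous 4 3 F × Irreducible F)
    × ((F G : Family 4) → Homogeneous 4 3 F → Irreducible F → Homogeneous 4 3 G → Irreducible G → Equivalent F G)
theorem2p60 =
  (λ n F hom irr → Homogeneous₃.n≡4 {F = F} hom irr) ,
  (F₄ , F₄-homogeneous , F₄-irreducible) ,
  (λ F G homF irrF homG irrG → flippedInto⇒equivalent {B = F₄} {F = F} {G = G}
    (F₄-flippedInto {F} homF irrF) (F₄-flippedInto {G} homG irrG))
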